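{- Let $q$ be a prime power, let $t\ge 2$ and $m\ge 1$ be integers, and let $h_0,\ldots,h_{m-1}$ be integers with $h_i\ge 1$ for $0\le i\le m-1$ and $h_0=\min\{h_i:0\le i\le m-1\}$. If there exists a $k$-parc $\mathcal{K}$ in $\Pi_{t-1}(q)$, with pencil $\Psi_0,\ldots,\Psi_q$ and $h_i=|\mathcal{K}\cap\Psi_i|$ for $0\le i\le m-1$, having $k=h_0+h_1+\cdots+h_{m-1}$ points, then there exists an ideal secret sharing scheme of parallel model with $k-h_0$ participants and of strength $t$.
   Context: Projective geometry. $\Pi_r(q)$ is the projective space of dimension $r$ over $GF(q)$. Points are (linearly) independent if vectors representing them are linearly independent. A $k$-arc in $\Pi_r(q)$ is a set of $k$ points any $r+1$ of which are independent. A pencil in $\Pi_r(q)$ is the set of all $q+1$ hyperplanes $\Psi_0,\ldots,\Psi_q$ of $\Pi_r(q)$ containing a given common subspace of dimension $r-2$. A $k$-parc (pencil arc) in $\Pi_r(q)$ with pencil $\Psi_0,\ldots,\Psi_q$ is a set $\mathcal{K}$ of $k$ points of $\Pi_r(q)$ such that: (a) for $0\le i\le q$, $\mathcal{K}\cap\Psi_i$ is an $h_i$-arc in the $(r-1)$-dimensional projective space $\Psi_i$, where $h_i=|\mathcal{K}\cap\Psi_i|$; (b) $\mathcal{K}\cap\Psi_i\cap\Psi_j=\emptyset$ for $i\ne j$; (c) any $r+1$ points of $\mathcal{K}$ not contained in any single $\Psi_i$ are independent. Secret sharing. Given finite sets $\mathcal{K}_0$ (keys), $\mathcal{S}$ (shares),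 $\mathcal{P}$ (participants) and a dealer $D\notin\mathcal{P}$, an access structure $\Gamma$ is a monotone (upward closed) family of subsets of $\mathcal{P}$; it is determined by its basis $\Gamma^*$, the set of its minimal members. A perfect secret sharing scheme realizing $\Gamma$ is represented by an array $M$ with rows indexed by a finite nonempty set $\mathcal{F}$ and columns indexed by $\{D\}\cup\mathcal{P}$, entries $M(f,D)\in\mathcal{K}_0$, $M(f,P)\in\mathcal{S}$, and $M(f,B)=(M(f,P):P\in B)$, such that: (1) if $B\in\Gamma$ and $M(f,B)=M(f',B)$ then $M(f,D)=M(f',D)$; (2) for any $B\subseteq\mathcal{P}$ with $B\notin\Gamma$ and any $f\in\mathcal{F}$, the number $|\{g\in\mathcal{F}:M(g,D)=K,\ M(g,B)=M(f,B)\}|$ is the same for every $K\in\mathcal{K}_0$. It is ideal if the information rate $\log_2|\mathcal{K}_0|/\log_2|\mathcal{S}|$ equals $1$ (so $|\mathcal{K}_0|=|\mathcal{S}|\ge2$). Parallel model of strength $t$: $\mathcal{P}$ is partitioned into mutually disjoint groups $G_1,\ldots,G_n$ and $\Gamma^*=\binom{\mathcal{P}}{t}\setminus\bigcup_{i=1}^n\binom{G_i}{t}$, i.e. the minimal authorized subsets are exactly the $t$-subsets of $\mathcal{P}$ not included in any single group. A scheme of parallel model of strength $t$ is a scheme realizing such an access structure. -}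

module Defs where

open import Level using (Level; 0ℓ; _⊔_)
open import Algebra.Apartness.Bundles using (HeytingField; HeytingCommutativeRing)
open import Algebra.Bundles using (CommutativeRing)
import Algebra.Properties.Semiring.Sum as Sum
open import Data.Fin.Base using (Fin)
open import Data.Fin.Subset using (Subset; _∈_; _⊆_; _⊂_; _∩_; ∣_∣; Nonempty; Empty)
open import Data.Nat.Base using (ℕ; suc; _≤_; _∸_; _^_; NonZero)
open import Data.Nat.Primality using (Prime)
open import Data.Product.Base using (Σ-syntax; ∃-syntax; _×_)
open import Data.Vec.Functional using (Vector)
open import Function.Base using (_∘_)
open import Function.Bundles using (Inverse; _⇔_; _↣_; Injection)
open import Function.Definitions using (Injective)
open import Relation.Binary.PropositionalEquality using (_≡_; _≢_; setoid)
open import Relation.Nullary.Negation using (¬_)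
open import Relation.Unary using (Pred; Decidable)

-- Working with a witnessing `Subset` avoids a decidability side condition on P.
_HasSize_ : ∀ {ℓ n} → Pred (Fin n) ℓ → ℕ → Set ℓ
_HasSize_ {n = n} P s = Σ[ S ∈ Subset n ] (∀ x → x ∈ S ⇔ P x) × ∣ S ∣ ≡ s

IsPrimePower : ℕ → Set
IsPrimePower q = ∃[ p ] ∃[ e ] Prime p × 1 ≤ e × q ≡ p ^ e

------------------------------------------------------------------------
-- Projective geometry

-- GF(q) is any field of order q.  With q elements _≈_ is decidable, and _#_ is
-- then the negation of _≈_, so a finite `HeytingField` is a finite field in
-- the usual sense.
HasOrder : ∀ {c ℓ₁ ℓ₂} → HeytingField c ℓ₁ ℓ₂ → ℕ → Set (c ⊔ ℓ₁)
HasOrder F q = Inverse (CommutativeRing.setoid R) (setoid (Fin q))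
  where R = HeytingCommutativeRing.commutativeRing (HeytingField.heytingCommutativeRing F)

module Projective {c ℓ₁ ℓ₂} (F : HeytingField c ℓ₁ ℓ₂) where

  open HeytingField F using (heytingCommutativeRing)
  open CommutativeRing (HeytingCommutativeRing.commutativeRing heytingCommutativeRing)
    using (Carrier; _≈_; _≉_; _*_; 0#; semiring)
  open Sum semiring using (sum)

  lincomb : ∀ {d n} → Vector Carrier d → Vector (Vector Carrier n) d → Vector Carrier n
  lincomb a v i = sum (λ j → a j * v j i)

  LinearlyIndependent : ∀ {d n} → Vector (Vector Carrier n) d → Set (c ⊔ ℓ₁)
  LinearlyIndependent v = ∀ a → (∀ i → lincomb a v i ≈ 0#) → ∀ j → a j ≈ 0#

  -- A point of the r-dimensional space, given by homogeneous coordinates;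
  -- equality of points is _∼_.
  record Point (r : ℕ) : Set (c ⊔ ℓ₁) where
    field
      coords  : Vector Carrier (suc r)
      nonzero : ¬ (∀ i → coords i ≈ 0#)

  open Point public

  infix 4 _∼_
  _∼_ : ∀ {r} → Point r → Point r → Set (c ⊔ ℓ₁)
  P ∼ Q = ∃[ a ] a ≉ 0# × (∀ i → coords P i ≈ a * coords Q i)

  Independent : ∀ {r d} → (Fin d → Point r) → Set (c ⊔ ℓ₁)
  Independent P = LinearlyIndependent (coords ∘ P)

  -- A subspace of the r-dimensional space given by a basis.  The index d is the
  -- number of basis vectors, so the projective dimension is d - 1; d = 0 is the
  -- empty subspace, of dimension -1.
  record Subspace (r d : ℕ) : Set (c ⊔ ℓ₁) where
    field
      basis       : Vector (Vector Carrier (suc r)) d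
      independent : LinearlyIndependent basis

  open Subspace public

  Hyperplane : ℕ → Set (c ⊔ ℓ₁)
  Hyperplane r = Subspace r r

  infix 4 _liesIn_ _⊑_ _≐_
  _liesIn_ : ∀ {r d} → Point r → Subspace r d → Set (c ⊔ ℓ₁)
  P liesIn U = ∃[ a ] ∀ i → coords P i ≈ lincomb a (basis U) i

  _⊑_ : ∀ {r d e} → Subspace r d → Subspace r e → Set (c ⊔ ℓ₁)
  U ⊑ V = ∀ P → P liesIn U → P liesIn V

  _≐_ : ∀ {r d e} → Subspace r d → Subspace r e → Set (c ⊔ ℓ₁)
  U ≐ V = U ⊑ V × V ⊑ U

  -- Meaningful for r ≥ 1: the axis has projective dimension r - 2, that is,
  -- r - 1 basis vectors.
  record IsPencil {q r : ℕ} (Ψ : Fin (suc q) → Hyperplane r) : Set (c ⊔ ℓ₁) where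
    field
      axis      : Subspace r (r ∸ 1)
      axis⊑Ψ    : ∀ i → axis ⊑ Ψ i
      distinct  : Injective _≡_ _≐_ Ψ
      exhausted : ∀ (H : Hyperplane r) → axis ⊑ H → ∃[ i ] H ≐ Ψ i

  -- The points K j with X j form an arc in the (d - 1)-dimensional projective
  -- space U: any d of them are independent.
  IsArcIn : ∀ {ℓ k r d} → Subspace r d → (Fin k → Point r) → Pred (Fin k) ℓ → Set (c ⊔ ℓ₁ ⊔ ℓ)
  IsArcIn {k = k} {d = d} U K X =
    (∀ j → X j → K j liesIn U) ×
    (∀ (s : Fin d ↣ Fin k) → (∀ a → X (Injection.to s a)) → Independent (K ∘ Injection.to s))

  -- A set of k points is a family indexed by Fin k, injective up to _∼_.
  record IsParc {q r k : ℕ} (Ψ : Fin (suc q) → Hyperplane r) (K : Fin k → Point r) : Set (c ⊔ ℓ₁) where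
    field
      pencil   : IsPencil Ψ
      distinct : Injective _≡_ _∼_ K
      arcs     : ∀ i → IsArcIn (Ψ i) K (λ j → K j liesIn Ψ i)
      disjoint : ∀ {i i′} → i ≢ i′ → ∀ j → ¬ (K j liesIn Ψ i × K j liesIn Ψ i′)
      generic  : ∀ (s : Fin (suc r) ↣ Fin k) →
                 ¬ (∃[ i ] ∀ a → K (Injection.to s a) liesIn Ψ i) →
                 Independent (K ∘ Injection.to s)

------------------------------------------------------------------------
-- Secret sharing, with participants Fin p

-- A family of subsets of a finite set is decidable classically; `decidable`
-- makes this explicit, and with it Γ is determined by its minimal members.
record AccessStructure (p : ℕ) : Set₁ where
  field
    Γ         : Pred (Subset p) 0ℓ
    decidable : Decidable Γ
    monotone  : ∀ {B C} → B ⊆ C → Γ B → Γ C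

open AccessStructure public

Minimal : ∀ {p} → AccessStructure p → Pred (Subset p) 0ℓ
Minimal 𝒜 B = Γ 𝒜 B × (∀ C → C ⊂ B → ¬ Γ 𝒜 C)

-- The array M: keys, shares and rows are numbered by Fin, `key` is the column of
-- the dealer and `share` gives the columns of the participants.
record PerfectScheme {p : ℕ} (𝒜 : AccessStructure p) : Set where
  field
    #keys #shares #rows : ℕ
    rows-nonempty       : NonZero #rows
    key                 : Fin #rows → Fin #keys
    share               : Fin #rows → Fin p → Fin #shares

  AgreeOn : Subset p → Fin #rows → Fin #rows → Set
  AgreeOn B f g = ∀ P → P ∈ B → share f P ≡ share g P

  field
    correct : ∀ B → Γ 𝒜 B → ∀ f f′ → AgreeOn B f f′ → key f ≡ key f′
    perfect : ∀ B → ¬ Γ 𝒜 B → ∀ f →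
              ∃[ N ] ∀ K → (λ g → key g ≡ K × AgreeOn B g f) HasSize N

-- Information rate log₂ #keys / log₂ #shares equal to 1.
IsIdeal : ∀ {p} {𝒜 : AccessStructure p} → PerfectScheme 𝒜 → Set
IsIdeal 𝒮 = #keys ≡ #shares × 2 ≤ #keys
  where open PerfectScheme 𝒮

record Partition (p n : ℕ) : Set where
  field
    group    : Fin n → Subset p
    nonempty : ∀ i → Nonempty (group i)
    disjoint : ∀ {i j} → i ≢ j → Empty (group i ∩ group j)
    covering : ∀ x → ∃[ i ] x ∈ group i

open Partition public using (group)

IsParallelModel : ∀ {p n} → ℕ → Partition p n → AccessStructure p → Set
IsParallelModel t G 𝒜 = ∀ B → Minimal 𝒜 B ⇔ (∣ B ∣ ≡ t × (∀ i → ¬ (B ⊆ group G i)))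

{-# OPTIONS --safe #-}
module Submission where

-- Put t = r + 1.  The participants are the points of the parc outside the first
-- hyperplane of the pencil, grouped by the hyperplane that contains them, and
-- the dealer takes one further point D of the parc, inside the first hyperplane.
-- The rows of the array are the linear functionals on the t-dimensional vector
-- space; the share of a participant is the value of the functional at the point
-- of the participant, and the key is its value at D.
--
-- Such a linear scheme realizes an access structure as soon as D is spanned by
-- the points of every authorized set, and for every other set some functional
-- takes the value 1 at D and vanishes on the points of the set: adding multiples
-- of this functional permutes the rows that agree on the set and moves the key to
-- any other value (compatible≤).  A set is authorized when it has at least t
-- members and lies in no group, so there are three cases.
--
--  * An authorized set contains t members not all in one group.  Their points lie
--    in no common hyperplane of the pencil, hence are independent and span the
--    whole space (authorized⇒spanned).
--  * A set of fewer than t members extends to t - 1 members.  Together with D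
--    their points lie in no common hyperplane of the pencil, because D lies only
--    in the first one; so they form a basis (small⇒separated).
--  * A set inside a group spans at most the hyperplane of the group, which does
--    not contain D (group⇒separated).
--
-- With fewer than t participants a small set may not extend, but no set is
-- authorized; then constant shares and a free key are used (trivialScheme).
--
-- The linear algebra rests on finiteness instead of a theory of dimension: taking
-- linear combinations of n independent vectors with n coordinates is an injective
-- endomap of the finite set of such vectors, hence surjective
-- (independent⇒spanning), and then so is evaluating functionals at these vectors
-- (independent⇒dual).

open import Defs
open import Level using (0ℓ)
open import Algebra.Apartness.Bundles using (HeytingField; HeytingCommutativeRing)
open import Algebra.Bundles using (CommutativeRing)
import Algebra.Properties.CommutativeSemigroup as CommutativeSemigroupProperties
import Algebra.Properties.Group as GroupProperties
import Algebra.Properties.Ring as RingProperties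
import Algebra.Properties.Semiring.Sum as SumProperties
open import Data.Fin.Base using (Fin; zero; suc; inject≤; fromℕ<; finToFun; funToFin; combine)
open import Data.Fin.Properties using (_≟_; all?; any?; suc-injective; injective⇒≤;
  inject≤-injective; finToFun-funToFin; funToFin-finToFin; ¬∀⟶∃¬)
open import Data.Fin.Subset using (Subset; inside; outside; _∈_; _∉_; _⊆_; _∪_;
  _─_; _-_; ∁; ⊤; ⁅_⁆; ∣_∣; Nonempty)
open import Data.Fin.Subset.Properties
open import Data.Nat.Base using (ℕ; zero; suc; _+_; _≤_; _<_; _∸_; _^_; z≤n; s≤s; >-nonZero)
import Data.Nat.Properties as ℕ
open import Data.Product.Base using (Σ-syntax; ∃-syntax; _×_; _,_; proj₁; proj₂)
open import Data.Sum.Base using (_⊎_; inj₁; inj₂; [_,_]′)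
open import Data.Vec.Base using ([]; _∷_; sum; tabulate; here; there)
open import Data.Vec.Properties using ([]=⇒lookup; lookup⇒[]=; lookup∘tabulate; tabulate-cong)
import Data.Vec.Functional as Vector
open import Data.Vec.Functional using (Vector)
open import Function.Base using (_∘_)
open import Function.Bundles using (Inverse; Injection; Equivalence; _⇔_; _↣_; mk⇔; mk↣)
open import Relation.Binary.PropositionalEquality
  using (_≡_; _≢_; refl; sym; trans; cong; cong₂; subst)
open import Relation.Nullary using (¬_; yes; no; does; contradiction; _×-dec_; _→-dec_; ¬?)
open import Relation.Nullary.Decidable using (dec-true; decidable-stable)
open import Relation.Unary using (Pred; Decidable)

------------------------------------------------------------------------
-- Subsets of a finite set

-- The subset cut out by a decidable predicate.
comprehension : ∀ {ℓ n} {P : Pred (Fin n) ℓ} → Decidable P → Subset n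
comprehension P? = tabulate (λ x → does (P? x))

∈-comprehension : ∀ {ℓ n} {P : Pred (Fin n) ℓ} (P? : Decidable P) x →
                  x ∈ comprehension P? ⇔ P x
∈-comprehension {P = P} P? x = mk⇔ to from
  where
  to : x ∈ comprehension P? → P x
  to x∈ with P? x | trans (sym (lookup∘tabulate (λ y → does (P? y)) x)) ([]=⇒lookup x∈)
  ... | yes p | _ = p
  ... | no _  | ()
  from : P x → x ∈ comprehension P?
  from p = lookup⇒[]= x _ (trans (lookup∘tabulate (λ y → does (P? y)) x) (dec-true (P? x) p))

-- A bijection between Fin s and the elements of S.
record Enumeration {n : ℕ} (S : Subset n) (s : ℕ) : Set where
  field
    embed : Fin s ↣ Fin n

  open Injection embed public using () renaming (to to element; injective to element-injective)

  field
    element∈ : ∀ i → element i ∈ S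
    index    : ∀ {x} → x ∈ S → Fin s
    element-index : ∀ {x} (x∈S : x ∈ S) → element (index x∈S) ≡ x

enumerate : ∀ {n} (S : Subset n) → Enumeration S ∣ S ∣
enumerate [] = record
  { embed = mk↣ {to = λ ()} (λ { {()} }) ; element∈ = λ () ; index = λ () ; element-index = λ () }
enumerate (outside ∷ S) = record
  { embed         = mk↣ {to = suc ∘ element} (element-injective ∘ suc-injective)
  ; element∈      = there ∘ element∈
  ; index         = λ { (there x∈S) → index x∈S }
  ; element-index = λ { (there x∈S) → cong suc (element-index x∈S) }
  }
  where open Enumeration (enumerate S)
enumerate {suc n} (inside ∷ S) = record
  { embed         = mk↣ {to = to} injective
  ; element∈      = λ { zero → here ; (suc i) → there (element∈ i) }
  ; index         = λ { here → zero ; (there x∈S) → suc (index x∈S) }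
  ; element-index = λ { here → refl ; (there x∈S) → cong suc (element-index x∈S) }
  }
  where
  open Enumeration (enumerate S)
  to : Fin (suc ∣ S ∣) → Fin (suc n)
  to zero    = zero
  to (suc i) = suc (element i)
  injective : ∀ {i j} → to i ≡ to j → i ≡ j
  injective {zero}  {zero}  _  = refl
  injective {suc i} {suc j} eq = cong suc (element-injective (suc-injective eq))

enumerateAs : ∀ {n s} (S : Subset n) → ∣ S ∣ ≡ s → Enumeration S s
enumerateAs S refl = enumerate S

1≤∣S∣⇒Nonempty : ∀ {n} {S : Subset n} → 1 ≤ ∣ S ∣ → Nonempty S
1≤∣S∣⇒Nonempty {S = S} 1≤∣S∣ with ∣ S ∣ | enumerate S
1≤∣S∣⇒Nonempty         (s≤s _) | suc _ | E = element zero , element∈ zero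
  where open Enumeration E

-- The map f need only be defined on A.
injection⇒∣∣≤ : ∀ {m n} {A : Subset m} {B : Subset n} (f : ∀ {x} → x ∈ A → Fin n) →
                (∀ {x} (x∈A : x ∈ A) → f x∈A ∈ B) →
                (∀ {x y} (x∈A : x ∈ A) (y∈A : y ∈ A) → f x∈A ≡ f y∈A → x ≡ y) →
                ∣ A ∣ ≤ ∣ B ∣
injection⇒∣∣≤ {A = A} {B} f f∈B f-injective =
  injective⇒≤ {f = λ i → B.index (f∈B (A.element∈ i))} λ {i} {j} eq →
    A.element-injective (f-injective (A.element∈ i) (A.element∈ j)
      (trans (sym (B.element-index (f∈B (A.element∈ i))))
        (trans (cong B.element eq) (B.element-index (f∈B (A.element∈ j))))))
  where
  module A = Enumeration (enumerate A)
  module B = Enumeration (enumerate B)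

∣p∪q∣≤∣p∣+∣q∣ : ∀ {n} (p q : Subset n) → ∣ p ∪ q ∣ ≤ ∣ p ∣ + ∣ q ∣
∣p∪q∣≤∣p∣+∣q∣ []            []            = z≤n
∣p∪q∣≤∣p∣+∣q∣ (outside ∷ p) (outside ∷ q) = ∣p∪q∣≤∣p∣+∣q∣ p q
∣p∪q∣≤∣p∣+∣q∣ (outside ∷ p) (inside  ∷ q) =
  ℕ.≤-trans (s≤s (∣p∪q∣≤∣p∣+∣q∣ p q)) (ℕ.≤-reflexive (sym (ℕ.+-suc ∣ p ∣ ∣ q ∣)))
∣p∪q∣≤∣p∣+∣q∣ (inside  ∷ p) (outside ∷ q) = s≤s (∣p∪q∣≤∣p∣+∣q∣ p q)
∣p∪q∣≤∣p∣+∣q∣ (inside  ∷ p) (inside  ∷ q) =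
  s≤s (ℕ.≤-trans (∣p∪q∣≤∣p∣+∣q∣ p q) (ℕ.+-monoʳ-≤ ∣ p ∣ (ℕ.n≤1+n ∣ q ∣)))

∣p∣+∣q─p∣≡∣q∣ : ∀ {n} {p q : Subset n} → p ⊆ q → ∣ p ∣ + ∣ q ─ p ∣ ≡ ∣ q ∣
∣p∣+∣q─p∣≡∣q∣ {p = []}          {[]}          _   = refl
∣p∣+∣q─p∣≡∣q∣ {p = outside ∷ p} {outside ∷ q} p⊆q = ∣p∣+∣q─p∣≡∣q∣ (drop-∷-⊆ p⊆q)
∣p∣+∣q─p∣≡∣q∣ {p = outside ∷ p} {inside  ∷ q} p⊆q =
  trans (ℕ.+-suc ∣ p ∣ ∣ q ─ p ∣) (cong suc (∣p∣+∣q─p∣≡∣q∣ (drop-∷-⊆ p⊆q)))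
∣p∣+∣q─p∣≡∣q∣ {p = inside  ∷ p} {outside ∷ q} p⊆q = contradiction (p⊆q here) λ ()
∣p∣+∣q─p∣≡∣q∣ {p = inside  ∷ p} {inside  ∷ q} p⊆q = cong suc (∣p∣+∣q─p∣≡∣q∣ (drop-∷-⊆ p⊆q))

-- Every size between those of nested subsets is attained in between.
interpolate : ∀ {n s} {A B : Subset n} → A ⊆ B → ∣ A ∣ ≤ s → s ≤ ∣ B ∣ →
              ∃[ C ] A ⊆ C × C ⊆ B × ∣ C ∣ ≡ s
interpolate {A = []} {[]} _ _ z≤n = [] , (λ ()) , (λ ()) , refl
interpolate {A = outside ∷ A} {outside ∷ B} A⊆B A≤s s≤B
  with C , A⊆C , C⊆B , eq ← interpolate (drop-∷-⊆ A⊆B) A≤s s≤B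
  = outside ∷ C , s⊆s A⊆C , s⊆s C⊆B , eq
interpolate {A = inside ∷ A} {outside ∷ B} A⊆B _ _ = contradiction (A⊆B here) λ ()
interpolate {A = inside ∷ A} {inside ∷ B} A⊆B (s≤s A≤s) (s≤s s≤B)
  with C , A⊆C , C⊆B , eq ← interpolate (drop-∷-⊆ A⊆B) A≤s s≤B
  = inside ∷ C , s⊆s A⊆C , s⊆s C⊆B , cong suc eq
interpolate {s = s} {outside ∷ A} {inside ∷ B} A⊆B A≤s s≤B with s ℕ.≤? ∣ B ∣
... | no s≰B =
  inside ∷ B , out⊆ (drop-∷-⊆ A⊆B) , ⊆-refl , ℕ.≤-antisym (ℕ.≰⇒> s≰B) s≤B
... | yes s≤∣B∣
  with C , A⊆C , C⊆B , eq ← interpolate (drop-∷-⊆ A⊆B) A≤s s≤∣B∣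
  = outside ∷ C , s⊆s A⊆C , out⊆ C⊆B , eq

disjoint⇒sum≤ : ∀ {n} m (S : Fin m → Subset n) {T : Subset n} → (∀ i → S i ⊆ T) →
                (∀ {i j x} → x ∈ S i → x ∈ S j → i ≡ j) →
                sum (tabulate (λ i → ∣ S i ∣)) ≤ ∣ T ∣
disjoint⇒sum≤ zero    S S⊆T disjoint = z≤n
disjoint⇒sum≤ (suc m) S {T} S⊆T disjoint = begin
  ∣ S zero ∣ + sum (tabulate (λ i → ∣ S (suc i) ∣)) ≤⟨ ℕ.+-monoʳ-≤ ∣ S zero ∣ rest ⟩
  ∣ S zero ∣ + ∣ T ─ S zero ∣                       ≡⟨ ∣p∣+∣q─p∣≡∣q∣ (S⊆T zero) ⟩
  ∣ T ∣                                             ∎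
  where
  open ℕ.≤-Reasoning
  rest = disjoint⇒sum≤ m (S ∘ suc) {T ─ S zero}
    (λ i x∈Sᵢ → x∈p∧x∉q⇒x∈p─q (S⊆T (suc i) x∈Sᵢ)
      λ x∈S₀ → contradiction (disjoint {zero} {suc i} x∈S₀ x∈Sᵢ) λ ())
    (λ x∈ x∈′ → suc-injective (disjoint x∈ x∈′))

-- A missed element x would leave room for at most n - 1 elements.
disjoint∧sum≡⇒cover : ∀ {m n} (S : Fin m → Subset n) →
                      (∀ {i j x} → x ∈ S i → x ∈ S j → i ≡ j) →
                      sum (tabulate (λ i → ∣ S i ∣)) ≡ n → ∀ x → ∃[ i ] x ∈ S i
disjoint∧sum≡⇒cover {m} {n} S disjoint sum≡n x =
  decidable-stable (any? (λ i → x ∈? S i)) λ missed → ℕ.<-irrefl refl (begin-strict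
    n                              ≡⟨ sum≡n ⟨
    sum (tabulate (λ i → ∣ S i ∣)) ≤⟨ disjoint⇒sum≤ m S (λ i → avoids (λ x∈ → missed (i , x∈))) disjoint ⟩
    ∣ ⊤ {n} - x ∣                  <⟨ x∈p⇒∣p-x∣<∣p∣ (∈⊤ {x = x}) ⟩
    ∣ ⊤ {n} ∣                      ≡⟨ ∣⊤∣≡n n ⟩
    n                              ∎)
  where
  open ℕ.≤-Reasoning
  avoids : ∀ {A} → x ∉ A → A ⊆ ⊤ - x
  avoids x∉A y∈A = x∈p∧x≢y⇒x∈p-y ∈⊤ λ { refl → x∉A y∈A }

-- Otherwise f would inject n elements into the n - 1 elements other than y.
injective⇒surjective : ∀ {n} {f : Fin n → Fin n} → (∀ {i j} → f i ≡ f j → i ≡ j) →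
                       ∀ y → ∃[ x ] f x ≡ y
injective⇒surjective {n} {f} f-injective y =
  decidable-stable (any? (λ x → f x ≟ y)) λ missed →
    ℕ.<-irrefl refl (begin-strict
      n                   ≡⟨ ∣⊤∣≡n n ⟨
      ∣ ⊤ {n} ∣           ≤⟨ injection⇒∣∣≤ {A = ⊤} (λ {x} _ → f x)
                              (λ {x} _ → x∈p∧x≢y⇒x∈p-y ∈⊤ (λ eq → missed (x , eq)))
                              (λ _ _ → f-injective) ⟩
      ∣ ⊤ {n} - y ∣       <⟨ x∈p⇒∣p-x∣<∣p∣ (∈⊤ {x = y}) ⟩
      ∣ ⊤ {n} ∣           ≡⟨ ∣⊤∣≡n n ⟩
      n                   ∎)
  where open ℕ.≤-Reasoning

------------------------------------------------------------------------
-- The access structure of the parallel model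

module _ {p n : ℕ} (G : Partition p n) (t : ℕ) where

  -- At least t members, not all in one group.
  Authorized : Pred (Subset p) 0ℓ
  Authorized B = t ≤ ∣ B ∣ × (∀ i → ¬ (B ⊆ group G i))

  parallelAccess : AccessStructure p
  parallelAccess = record
    { Γ         = Authorized
    ; decidable = λ B → (t ℕ.≤? ∣ B ∣) ×-dec all? (λ i → ¬? (B ⊆? group G i))
    ; monotone  = λ {B} {C} B⊆C (t≤B , B⊈G) →
        ℕ.≤-trans t≤B (p⊆q⇒∣p∣≤∣q∣ B⊆C) , λ i C⊆G → B⊈G i (⊆-trans {i = B} {j = C} B⊆C C⊆G)
    }

  group-unique : ∀ {i j x} → x ∈ group G i → x ∈ group G j → i ≡ j
  group-unique {i} {j} {x} x∈Gᵢ x∈Gⱼ = decidable-stable (i ≟ j) λ i≢j →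
    Partition.disjoint G i≢j (x , x∈p∩q⁺ (x∈Gᵢ , x∈Gⱼ))

  -- Two members of B in different groups extend, inside B, to t members.
  authorized⇒basis : 2 ≤ t → ∀ {B} → Authorized B →
                     ∃[ C ] C ⊆ B × ∣ C ∣ ≡ t × (∀ i → ¬ (C ⊆ group G i))
  authorized⇒basis 2≤t {B} (t≤B , B⊈G) = C , C⊆B , ∣C∣≡t , C⊈G
    where
    nonempty = 1≤∣S∣⇒Nonempty {S = B} (ℕ.≤-trans (s≤s z≤n) (ℕ.≤-trans 2≤t t≤B))
    a   = proj₁ nonempty
    a∈B = proj₂ nonempty
    i    = proj₁ (Partition.covering G a)
    a∈Gᵢ = proj₂ (Partition.covering G a)
    outsider : ∃[ b ] ¬ (b ∈ B → b ∈ group G i)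
    outsider = ¬∀⟶∃¬ p (λ b → b ∈ B → b ∈ group G i)
      (λ b → (b ∈? B) →-dec (b ∈? group G i)) λ B⊆Gᵢ → B⊈G i (λ {b} → B⊆Gᵢ b)
    b = proj₁ outsider
    b∈B : b ∈ B
    b∈B = decidable-stable (b ∈? B) λ b∉B → proj₂ outsider λ b∈B → contradiction b∈B b∉B
    pair⊆B : ⁅ a ⁆ ∪ ⁅ b ⁆ ⊆ B
    pair⊆B y∈ with x∈p∪q⁻ ⁅ a ⁆ ⁅ b ⁆ y∈
    ... | inj₁ y∈a = subst (_∈ B) (sym (x∈⁅y⁆⇒x≡y a y∈a)) a∈B
    ... | inj₂ y∈b = subst (_∈ B) (sym (x∈⁅y⁆⇒x≡y b y∈b)) b∈B
    pair≤t : ∣ ⁅ a ⁆ ∪ ⁅ b ⁆ ∣ ≤ t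
    pair≤t = ℕ.≤-trans (∣p∪q∣≤∣p∣+∣q∣ ⁅ a ⁆ ⁅ b ⁆)
      (subst (_≤ t) (sym (cong₂ _+_ (∣⁅x⁆∣≡1 a) (∣⁅x⁆∣≡1 b))) 2≤t)
    interpolant = interpolate pair⊆B pair≤t t≤B
    C = proj₁ interpolant
    pair⊆C = proj₁ (proj₂ interpolant)
    C⊆B = proj₁ (proj₂ (proj₂ interpolant))
    ∣C∣≡t = proj₂ (proj₂ (proj₂ interpolant))
    C⊈G : ∀ j → ¬ (C ⊆ group G j)
    C⊈G j C⊆Gⱼ = proj₂ outsider λ _ →
      subst (λ g → b ∈ group G g) (group-unique a∈Gⱼ a∈Gᵢ) b∈Gⱼ
      where
      a∈Gⱼ = C⊆Gⱼ (pair⊆C (p⊆p∪q ⁅ b ⁆ (x∈⁅x⁆ a)))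
      b∈Gⱼ = C⊆Gⱼ (pair⊆C (q⊆p∪q ⁅ a ⁆ ⁅ b ⁆ (x∈⁅x⁆ b)))

  parallelAccess-isParallelModel : 2 ≤ t → IsParallelModel t G parallelAccess
  parallelAccess-isParallelModel 2≤t B = mk⇔ to from
    where
    to : Minimal parallelAccess B → ∣ B ∣ ≡ t × (∀ i → ¬ (B ⊆ group G i))
    to (B-authorized@(t≤B , B⊈G) , minimal)
      with C , C⊆B , ∣C∣≡t , C⊈G ← authorized⇒basis 2≤t B-authorized
      = trans (cong ∣_∣ (⊆-antisym B⊆C C⊆B)) ∣C∣≡t , B⊈G
      where
      B⊆C : B ⊆ C
      B⊆C {x} x∈B = decidable-stable (x ∈? C) λ x∉C →
        minimal C (C⊆B , x , x∈B , x∉C) (ℕ.≤-reflexive (sym ∣C∣≡t) , C⊈G)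
    from : ∣ B ∣ ≡ t × (∀ i → ¬ (B ⊆ group G i)) → Minimal parallelAccess B
    from (∣B∣≡t , B⊈G) = (ℕ.≤-reflexive (sym ∣B∣≡t) , B⊈G) , λ C C⊂B (t≤C , _) →
      ℕ.<⇒≱ (p⊂q⇒∣p∣<∣q∣ C⊂B) (subst (_≤ ∣ C ∣) (sym ∣B∣≡t) t≤C)

  unauthorized : ∀ {B} → ¬ Authorized B → ∣ B ∣ < t ⊎ ∃[ i ] B ⊆ group G i
  unauthorized {B} ¬auth with t ℕ.≤? ∣ B ∣ | any? (λ i → B ⊆? group G i)
  ... | no t≰B | _       = inj₁ (ℕ.≰⇒> t≰B)
  ... | yes _  | yes B⊆G = inj₂ B⊆G
  ... | yes t≤B | no B⊈G = contradiction (t≤B , λ i B⊆Gᵢ → B⊈G (i , λ {x} → B⊆Gᵢ {x})) ¬auth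

-- When no set is authorized, constant shares and a free key do.
trivialScheme : ∀ {p} (𝒜 : AccessStructure p) → (∀ B → ¬ Γ 𝒜 B) →
                Σ[ 𝒮 ∈ PerfectScheme 𝒜 ] IsIdeal 𝒮
trivialScheme 𝒜 ¬Γ = record
  { #keys         = 2
  ; #shares       = 2
  ; #rows         = 2
  ; rows-nonempty = _
  ; key           = λ f → f
  ; share         = λ _ _ → zero
  ; correct       = λ B B∈Γ → contradiction B∈Γ (¬Γ B)
  ; perfect       = λ B _ f → 1 , λ K → ⁅ K ⁆ ,
      (λ x → mk⇔ (λ x∈ → x∈⁅y⁆⇒x≡y K x∈ , λ _ _ → refl)
                 (λ (eq , _) → subst (_∈ ⁅ K ⁆) (sym eq) (x∈⁅x⁆ K))) ,
      ∣⁅x⁆∣≡1 K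
  } , refl , ℕ.≤-refl

------------------------------------------------------------------------
-- Linear algebra over a finite field

module LinearAlgebra {c ℓ₁ ℓ₂} (F : HeytingField c ℓ₁ ℓ₂) where

  open Projective F
  open HeytingField F using (heytingCommutativeRing; #⇒invertible; invertible⇒#; #-irrefl; tight; _#_)
  open CommutativeRing (HeytingCommutativeRing.commutativeRing heytingCommutativeRing)
    hiding (zero; refl)
    renaming (_+_ to _⊕_; _-_ to _⊖_; sym to ≈-sym; trans to ≈-trans)
  open SumProperties semiring
    using (sum-cong-≋; ∑-distrib-+; ∑-comm; *-distribˡ-sum; sum-replicate-zero)
    renaming (sum to ∑)
  open CommutativeSemigroupProperties *-commutativeSemigroup using (x∙yz≈y∙xz)
  open GroupProperties +-group using () renaming
    ( ∙-cancelʳ to +-cancelʳ; identityˡ-unique to +-identityˡ-unique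
    ; inverseˡ-unique to +-inverseˡ-unique )
  open RingProperties ring using (-‿distribˡ-*; -‿distribʳ-*)
  open import Relation.Binary.Reasoning.Setoid setoid

  -- Coordinatewise equality of vectors.
  infix 4 _≋_
  _≋_ : ∀ {n} → Vector Carrier n → Vector Carrier n → Set ℓ₁
  v ≋ w = ∀ i → v i ≈ w i

  x⊖y⊕y≈x : ∀ x y → (x ⊖ y) ⊕ y ≈ x
  x⊖y⊕y≈x x y = begin
    (x ⊖ y) ⊕ y   ≈⟨ +-assoc x (- y) y ⟩
    x ⊕ (- y ⊕ y) ≈⟨ +-congˡ (-‿inverseˡ y) ⟩
    x ⊕ 0#        ≈⟨ +-identityʳ x ⟩
    x             ∎

  -- The vector g, read as a linear functional, evaluated at v.
  dot : ∀ {n} → Vector Carrier n → Vector Carrier n → Carrier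
  dot g v = ∑ (λ i → g i * v i)

  dot-congˡ : ∀ {n} (g : Vector Carrier n) {v w} → v ≋ w → dot g v ≈ dot g w
  dot-congˡ g v≋w = sum-cong-≋ (λ i → *-congˡ (v≋w i))

  dot-congʳ : ∀ {n} (v : Vector Carrier n) {g h} → g ≋ h → dot g v ≈ dot h v
  dot-congʳ v g≋h = sum-cong-≋ (λ i → *-congʳ (g≋h i))

  dot-lincomb : ∀ {d n} (g : Vector Carrier n) a (v : Vector (Vector Carrier n) d) →
                dot g (lincomb a v) ≈ dot a (λ j → dot g (v j))
  dot-lincomb g a v = begin
    ∑ (λ i → g i * ∑ (λ j → a j * v j i))
      ≈⟨ sum-cong-≋ (λ i → *-distribˡ-sum (g i) (λ j → a j * v j i)) ⟩
    ∑ (λ i → ∑ (λ j → g i * (a j * v j i)))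
      ≈⟨ ∑-comm (λ i j → g i * (a j * v j i)) ⟩
    ∑ (λ j → ∑ (λ i → g i * (a j * v j i)))
      ≈⟨ sum-cong-≋ (λ j → sum-cong-≋ (λ i → x∙yz≈y∙xz (g i) (a j) (v j i))) ⟩
    ∑ (λ j → ∑ (λ i → a j * (g i * v j i)))
      ≈⟨ sum-cong-≋ (λ j → *-distribˡ-sum (a j) (λ i → g i * v j i)) ⟨
    ∑ (λ j → a j * ∑ (λ i → g i * v j i))   ∎

  dot-lincomb-zero : ∀ {d n} (g : Vector Carrier n) a {v : Vector (Vector Carrier n) d} {w} →
                     w ≋ lincomb a v → (∀ j → dot g (v j) ≈ 0#) → dot g w ≈ 0#
  dot-lincomb-zero {d} g a {v} {w} w≋ g·v≈0 = begin
    dot g w                    ≈⟨ dot-congˡ g w≋ ⟩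
    dot g (lincomb a v)        ≈⟨ dot-lincomb g a v ⟩
    dot a (λ j → dot g (v j))  ≈⟨ sum-cong-≋ (λ j → ≈-trans (*-congˡ (g·v≈0 j)) (zeroʳ (a j))) ⟩
    ∑ {d} (λ j → 0#)           ≈⟨ sum-replicate-zero d ⟩
    0#                         ∎

  dot-+* : ∀ {n} (g h : Vector Carrier n) x v →
           dot (λ i → g i ⊕ x * h i) v ≈ dot g v ⊕ x * dot h v
  dot-+* g h x v = begin
    ∑ (λ i → (g i ⊕ x * h i) * v i)
      ≈⟨ sum-cong-≋ (λ i → ≈-trans (distribʳ (v i) (g i) (x * h i)) (+-congˡ (*-assoc x (h i) (v i)))) ⟩
    ∑ (λ i → g i * v i ⊕ x * (h i * v i))
      ≈⟨ ∑-distrib-+ (λ i → g i * v i) (λ i → x * (h i * v i)) ⟩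
    dot g v ⊕ ∑ (λ i → x * (h i * v i))
      ≈⟨ +-congˡ (*-distribˡ-sum x (λ i → h i * v i)) ⟨
    dot g v ⊕ x * dot h v ∎

  -- The standard basis vectors.
  δ : ∀ {n} → Fin n → Vector Carrier n
  δ zero    zero    = 1#
  δ zero    (suc j) = 0#
  δ (suc i) zero    = 0#
  δ (suc i) (suc j) = δ i j

  dot-δ : ∀ {n} (g : Vector Carrier n) i → dot g (δ i) ≈ g i
  dot-δ {suc n} g zero = begin
    g zero * 1# ⊕ ∑ (λ j → g (suc j) * 0#) ≈⟨ +-congʳ (*-identityʳ (g zero)) ⟩
    g zero ⊕ ∑ (λ j → g (suc j) * 0#)      ≈⟨ +-congˡ (sum-cong-≋ (λ j → zeroʳ (g (suc j)))) ⟩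
    g zero ⊕ ∑ {n} (λ j → 0#)              ≈⟨ +-congˡ (sum-replicate-zero n) ⟩
    g zero ⊕ 0#                            ≈⟨ +-identityʳ (g zero) ⟩
    g zero                                 ∎
  dot-δ {suc n} g (suc i) = begin
    g zero * 0# ⊕ dot (g ∘ suc) (δ i) ≈⟨ +-cong (zeroʳ (g zero)) (dot-δ (g ∘ suc) i) ⟩
    0# ⊕ g (suc i)                    ≈⟨ +-identityˡ (g (suc i)) ⟩
    g (suc i)                         ∎

  lincomb-injective : ∀ {d n} {v : Vector (Vector Carrier n) d} → LinearlyIndependent v →
                      ∀ {a b} → lincomb a v ≋ lincomb b v → a ≋ b
  lincomb-injective {v = v} independent {a} {b} eq j = begin
    a j               ≈⟨ x⊖y⊕y≈x (a j) (b j) ⟨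
    (a j ⊖ b j) ⊕ b j ≈⟨ +-congʳ (independent (λ j → a j ⊖ b j) difference≈0 j) ⟩
    0# ⊕ b j          ≈⟨ +-identityˡ (b j) ⟩
    b j               ∎
    where
    difference≈0 : ∀ i → lincomb (λ j → a j ⊖ b j) v i ≈ 0#
    difference≈0 i = +-identityˡ-unique _ (lincomb b v i) (begin
      lincomb (λ j → a j ⊖ b j) v i ⊕ lincomb b v i
        ≈⟨ ∑-distrib-+ (λ j → (a j ⊖ b j) * v j i) (λ j → b j * v j i) ⟨
      ∑ (λ j → (a j ⊖ b j) * v j i ⊕ b j * v j i)
        ≈⟨ sum-cong-≋ (λ j → distribʳ (v j i) (a j ⊖ b j) (b j)) ⟨
      ∑ (λ j → ((a j ⊖ b j) ⊕ b j) * v j i)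
        ≈⟨ sum-cong-≋ (λ j → *-congʳ (x⊖y⊕y≈x (a j) (b j))) ⟩
      lincomb a v i
        ≈⟨ eq i ⟩
      lincomb b v i ∎)

  1≉0 : ¬ 1# ≈ 0#
  1≉0 1≈0 = #-irrefl 1≈0 (invertible⇒# (1# , 1*[1⊖0]≈1 , ≈-trans (*-comm _ _) 1*[1⊖0]≈1))
    where
    1*[1⊖0]≈1 : 1# * (1# ⊖ 0#) ≈ 1#
    1*[1⊖0]≈1 = ≈-trans (*-identityˡ _) (≈-trans (≈-sym (+-identityʳ _)) (x⊖y⊕y≈x 1# 0#))

  -- In a relation between D and v the coefficient of D vanishes: by tightness
  -- it suffices that it is not apart from 0, and an invertible coefficient would
  -- put D into the span of v.
  adjoin-independent : ∀ {d n} {D : Vector Carrier n} {v : Vector (Vector Carrier n) d} →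
                       LinearlyIndependent v → ¬ (∃[ a ] D ≋ lincomb a v) →
                       LinearlyIndependent (D Vector.∷ v)
  adjoin-independent {D = D} {v} independent D∉span a relation = λ
    { zero    → a₀≈0
    ; (suc j) → independent (a ∘ suc) tail≈0 j }
    where
    a₀ = a zero
    L  = lincomb (a ∘ suc) v
    ¬a₀#0 : ¬ a₀ # 0#
    ¬a₀#0 a₀#0 with b , b*[a₀⊖0]≈1 , _ ← #⇒invertible a₀#0
      = D∉span ((λ j → - b * a (suc j)) , D≈)
      where
      b*a₀≈1 : b * a₀ ≈ 1#
      b*a₀≈1 = ≈-trans (*-congˡ (≈-trans (≈-sym (x⊖y⊕y≈x a₀ 0#)) (+-identityʳ _))) b*[a₀⊖0]≈1
      D≈ : ∀ i → D i ≈ lincomb (λ j → - b * a (suc j)) v i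
      D≈ i = begin
        D i                                 ≈⟨ *-identityˡ (D i) ⟨
        1# * D i                            ≈⟨ *-congʳ b*a₀≈1 ⟨
        (b * a₀) * D i                      ≈⟨ *-assoc b a₀ (D i) ⟩
        b * (a₀ * D i)                      ≈⟨ *-congˡ (+-inverseˡ-unique (a₀ * D i) (L i) (relation i)) ⟩
        b * - L i                           ≈⟨ -‿distribʳ-* b (L i) ⟨
        - (b * L i)                         ≈⟨ -‿distribˡ-* b (L i) ⟩
        - b * L i                           ≈⟨ *-distribˡ-sum (- b) (λ j → a (suc j) * v j i) ⟩
        ∑ (λ j → - b * (a (suc j) * v j i)) ≈⟨ sum-cong-≋ (λ j → *-assoc (- b) (a (suc j)) (v j i)) ⟨
        lincomb (λ j → - b * a (suc j)) v i ∎
    a₀≈0 : a₀ ≈ 0#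
    a₀≈0 = proj₁ (tight a₀ 0#) ¬a₀#0
    tail≈0 : ∀ i → L i ≈ 0#
    tail≈0 i = begin
      L i            ≈⟨ +-identityˡ (L i) ⟨
      0# ⊕ L i       ≈⟨ +-congʳ (zeroˡ (D i)) ⟨
      0# * D i ⊕ L i ≈⟨ +-congʳ (*-congʳ a₀≈0) ⟨
      a₀ * D i ⊕ L i ≈⟨ relation i ⟩
      0#             ∎

  module Finite {q : ℕ} (order : HasOrder F q) where

    open Inverse order using ()
      renaming (to to toFin; from to fromFin; to-cong to toFin-cong;
                strictlyInverseˡ to toFin-fromFin; strictlyInverseʳ to fromFin-toFin)

    toFin-injective : ∀ {x y} → toFin x ≡ toFin y → x ≈ y
    toFin-injective {x} {y} eq = begin
      x                 ≈⟨ fromFin-toFin x ⟨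
      fromFin (toFin x) ≡⟨ cong fromFin eq ⟩
      fromFin (toFin y) ≈⟨ fromFin-toFin y ⟩
      y                 ∎

    1<q : 1 < q
    1<q = injective⇒≤ {f = bit} λ
      { {zero}     {zero}     _  → refl
      ; {zero}     {suc zero} eq → contradiction (≈-sym (toFin-injective eq)) 1≉0
      ; {suc zero} {zero}     eq → contradiction (toFin-injective eq) 1≉0
      ; {suc zero} {suc zero} _  → refl }
      where
      bit : Fin 2 → Fin q
      bit zero    = toFin 0#
      bit (suc _) = toFin 1#

    -- The q ^ n vectors with n coordinates are numbered by Fin (q ^ n).
    encode : ∀ {n} → Vector Carrier n → Fin (q ^ n)
    encode v = funToFin (toFin ∘ v)

    decode : ∀ {n} → Fin (q ^ n) → Vector Carrier n
    decode x i = fromFin (finToFun x i)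

    decode-encode : ∀ {n} (v : Vector Carrier n) → decode (encode v) ≋ v
    decode-encode v i = begin
      fromFin (finToFun (funToFin (toFin ∘ v)) i) ≡⟨ cong fromFin (finToFun-funToFin (toFin ∘ v) i) ⟩
      fromFin (toFin (v i))                       ≈⟨ fromFin-toFin (v i) ⟩
      v i                                         ∎

    encode-injective : ∀ {n} {v w : Vector Carrier n} → encode v ≡ encode w → v ≋ w
    encode-injective {v = v} {w} eq i = begin
      v i                 ≈⟨ decode-encode v i ⟨
      decode (encode v) i ≡⟨ cong (λ x → decode x i) eq ⟩
      decode (encode w) i ≈⟨ decode-encode w i ⟩
      w i                 ∎

    funToFin-cong : ∀ {m n} {f g : Fin m → Fin n} → (∀ i → f i ≡ g i) → funToFin f ≡ funToFin g
    funToFin-cong {zero}  f≗g = refl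
    funToFin-cong {suc m} f≗g = cong₂ combine (f≗g zero) (funToFin-cong (f≗g ∘ suc))

    decode-injective : ∀ {n} {x y : Fin (q ^ n)} → decode {n} x ≋ decode y → x ≡ y
    decode-injective {n} {x} {y} eq =
      trans (sym (funToFin-finToFin {n} x)) (trans (funToFin-cong finToFun-eq) (funToFin-finToFin {n} y))
      where
      finToFun-eq : ∀ i → finToFun {q} {n} x i ≡ finToFun y i
      finToFun-eq i = trans (sym (toFin-fromFin _)) (trans (toFin-cong (eq i)) (toFin-fromFin _))

    vector-injective⇒surjective : ∀ {n} {φ : Vector Carrier n → Vector Carrier n} →
                                  (∀ {v w} → φ v ≋ φ w → v ≋ w) → ∀ w → ∃[ v ] φ v ≋ w
    vector-injective⇒surjective {φ = φ} φ-injective w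
      with x , eq ← injective⇒surjective {f = encode ∘ φ ∘ decode}
                      (decode-injective ∘ φ-injective ∘ encode-injective) (encode w)
      = decode x , encode-injective eq

    independent⇒spanning : ∀ {n} {v : Vector (Vector Carrier n) n} → LinearlyIndependent v →
                           ∀ w → ∃[ a ] lincomb a v ≋ w
    independent⇒spanning independent = vector-injective⇒surjective (lincomb-injective independent)

    -- Prescribed values on a basis v are attained by some functional: the map
    -- sending a functional to its values on v is injective because v spans.
    independent⇒dual : ∀ {n} {v : Vector (Vector Carrier n) n} → LinearlyIndependent v →
                       ∀ w → ∃[ g ] ∀ j → dot g (v j) ≈ w j
    independent⇒dual {v = v} independent = vector-injective⇒surjective values-injective
      where
      values-injective : ∀ {g h} → (∀ j → dot g (v j) ≈ dot h (v j)) → g ≋ h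
      values-injective {g} {h} eq i with a , a·v≋δᵢ ← independent⇒spanning independent (δ i) = begin
        g i                        ≈⟨ dot-δ g i ⟨
        dot g (δ i)                ≈⟨ dot-congˡ g a·v≋δᵢ ⟨
        dot g (lincomb a v)        ≈⟨ dot-lincomb g a v ⟩
        dot a (λ j → dot g (v j))  ≈⟨ dot-congˡ a eq ⟩
        dot a (λ j → dot h (v j))  ≈⟨ dot-lincomb h a v ⟨
        dot h (lincomb a v)        ≈⟨ dot-congˡ h a·v≋δᵢ ⟩
        dot h (δ i)                ≈⟨ dot-δ h i ⟩
        h i                        ∎

    -- The linear scheme: a row is a functional, the key and the shares are its
    -- values at D and at the v P.
    module LinearScheme
             {p n : ℕ} (𝒜 : AccessStructure p)
             (D : Vector Carrier n) (v : Fin p → Vector Carrier n)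
             (spanned   : ∀ B → Γ 𝒜 B → ∃[ d ] Σ[ e ∈ (Fin d → Fin p) ] (∀ j → e j ∈ B) ×
                          ∃[ a ] D ≋ lincomb a (v ∘ e))
             (separated : ∀ B → ¬ Γ 𝒜 B → ∃[ g ] dot g D ≈ 1# × (∀ P → P ∈ B → dot g (v P) ≈ 0#))
             where

      key : Fin (q ^ n) → Fin q
      key f = toFin (dot (decode f) D)

      share : Fin (q ^ n) → Fin p → Fin q
      share f P = toFin (dot (decode f) (v P))

      AgreeOn : Subset p → Fin (q ^ n) → Fin (q ^ n) → Set
      AgreeOn B f g = ∀ P → P ∈ B → share f P ≡ share g P

      correct : ∀ B → Γ 𝒜 B → ∀ f g → AgreeOn B f g → key f ≡ key g
      correct B B∈Γ f g agree with _ , e , e∈B , a , D≋ ← spanned B B∈Γ = toFin-cong (begin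
        dot (decode f) D                            ≈⟨ expand f ⟩
        dot a (λ j → dot (decode f) (v (e j)))      ≈⟨ dot-congˡ a
                                                         (λ j → toFin-injective (agree (e j) (e∈B j))) ⟩
        dot a (λ j → dot (decode g) (v (e j)))      ≈⟨ expand g ⟨
        dot (decode g) D                            ∎)
        where
        expand : ∀ f → dot (decode f) D ≈ dot a (λ j → dot (decode f) (v (e j)))
        expand f = ≈-trans (dot-congˡ (decode f) D≋) (dot-lincomb (decode f) a (v ∘ e))

      -- The rows with key K that agree with f on B.
      compatible? : ∀ B f K → Decidable (λ g → key g ≡ K × AgreeOn B g f)
      compatible? B f K g =
        (key g ≟ K) ×-dec all? (λ P → (P ∈? B) →-dec (share g P ≟ share f P))

      -- Adding a suitable multiple of a functional that vanishes on B but not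
      -- at D turns rows with key K into rows with key K′.
      compatible≤ : ∀ B → ¬ Γ 𝒜 B → ∀ f K K′ →
                    ∣ comprehension (compatible? B f K) ∣ ≤ ∣ comprehension (compatible? B f K′) ∣
      compatible≤ B B∉Γ f K K′ with h , h·D≈1 , h·B≈0 ← separated B B∉Γ =
        injection⇒∣∣≤ (λ {g} _ → shift g)
          (λ {g} g∈ → Equivalence.from (∈-comprehension (compatible? B f K′) (shift g))
            (shift-compatible g (Equivalence.to (∈-comprehension (compatible? B f K) g) g∈)))
          (λ {g} {g′} _ _ eq → decode-injective (λ i →
            +-cancelʳ (x * h i) _ _ (encode-injective eq i)))
        where
        x = fromFin K′ ⊖ fromFin K
        shift : Fin (q ^ n) → Fin (q ^ n)
        shift g = encode (λ i → decode g i ⊕ x * h i)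
        shift-dot : ∀ g w → dot (decode (shift g)) w ≈ dot (decode g) w ⊕ x * dot h w
        shift-dot g w = ≈-trans
          (dot-congʳ w (decode-encode (λ i → decode g i ⊕ x * h i)))
          (dot-+* (decode g) h x w)
        shift-compatible : ∀ g → key g ≡ K × AgreeOn B g f →
                           key (shift g) ≡ K′ × AgreeOn B (shift g) f
        shift-compatible g (refl , agree) =
          trans (toFin-cong key≈) (toFin-fromFin K′) ,
          λ P P∈B → trans (toFin-cong (share≈ P P∈B)) (agree P P∈B)
          where
          gD = dot (decode g) D
          key≈ : dot (decode (shift g)) D ≈ fromFin K′
          key≈ = begin
            dot (decode (shift g)) D        ≈⟨ shift-dot g D ⟩
            gD ⊕ x * dot h D                ≈⟨ +-congˡ (≈-trans (*-congˡ h·D≈1) (*-identityʳ x)) ⟩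
            gD ⊕ x                          ≈⟨ +-comm gD x ⟩
            x ⊕ gD                          ≈⟨ +-congˡ (fromFin-toFin gD) ⟨
            x ⊕ fromFin K                   ≈⟨ x⊖y⊕y≈x (fromFin K′) (fromFin K) ⟩
            fromFin K′                      ∎
          share≈ : ∀ P → P ∈ B → dot (decode (shift g)) (v P) ≈ dot (decode g) (v P)
          share≈ P P∈B = begin
            dot (decode (shift g)) (v P)              ≈⟨ shift-dot g (v P) ⟩
            dot (decode g) (v P) ⊕ x * dot h (v P)    ≈⟨ +-congˡ (≈-trans (*-congˡ (h·B≈0 P P∈B)) (zeroʳ x)) ⟩
            dot (decode g) (v P) ⊕ 0#                 ≈⟨ +-identityʳ _ ⟩
            dot (decode g) (v P)                      ∎

      scheme : Σ[ 𝒮 ∈ PerfectScheme 𝒜 ] IsIdeal 𝒮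
      scheme = record
        { #keys         = q
        ; #shares       = q
        ; #rows         = q ^ n
        ; rows-nonempty = ℕ.m^n≢0 q n {{>-nonZero (ℕ.<-trans (s≤s z≤n) 1<q)}}
        ; key           = key
        ; share         = share
        ; correct       = correct
        ; perfect       = λ B B∉Γ f → ∣ comprehension (compatible? B f (key f)) ∣ , λ K →
            comprehension (compatible? B f K) ,
            ∈-comprehension (compatible? B f K) ,
            ℕ.≤-antisym (compatible≤ B B∉Γ f K (key f)) (compatible≤ B B∉Γ f (key f) K)
        } , refl , 1<q

------------------------------------------------------------------------
-- Schemes from points of a projective space

module Construction {c ℓ₁ ℓ₂} {q : ℕ} (F : HeytingField c ℓ₁ ℓ₂) (order : HasOrder F q) where

  open Projective F
  open LinearAlgebra F
  open Finite order
  open HeytingField F using (Carrier; _≈_; 0#; 1#)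
  open CommutativeRing (HeytingCommutativeRing.commutativeRing (HeytingField.heytingCommutativeRing F))
    using () renaming (sym to ≈-sym)

  -- Participant P has the point `point P`, and the points of group i lie in the
  -- hyperplane H i, which misses the point of the dealer.  Points of participants
  -- not all in one group, or of the dealer and of participants, are independent
  -- if they are r + 1 in number.
  module PointScheme
    {r p n : ℕ} (1≤r : 1 ≤ r) (G : Partition p n)
    (dealer : Point r) (point : Fin p → Point r) (H : Fin n → Hyperplane r)
    (point∈H         : ∀ {i P} → P ∈ group G i → point P liesIn H i)
    (dealer∉H        : ∀ i → ¬ dealer liesIn H i)
    (points-generic  : ∀ (s : Fin (suc r) ↣ Fin p) →
                       (∀ i → ¬ (∀ a → Injection.to s a ∈ group G i)) →
                       Independent (point ∘ Injection.to s))
    (dealer-generic  : ∀ (s : Fin r ↣ Fin p) → Independent (dealer Vector.∷ (point ∘ Injection.to s)))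
    where

    D : Vector Carrier (suc r)
    D = coords dealer

    v : Fin p → Vector Carrier (suc r)
    v = coords ∘ point

    -- The values prescribed on a basis that starts with D.
    dealerValues : Vector Carrier (suc r)
    dealerValues = 1# Vector.∷ Vector.replicate r 0#

    -- Some functional distinguishes D from the points of B.
    Separated : Subset p → Set _
    Separated B = ∃[ g ] dot g D ≈ 1# × (∀ P → P ∈ B → dot g (v P) ≈ 0#)

    authorized⇒spanned : ∀ B → Authorized G (suc r) B →
      ∃[ d ] Σ[ e ∈ (Fin d → Fin p) ] (∀ j → e j ∈ B) × ∃[ a ] D ≋ lincomb a (v ∘ e)
    authorized⇒spanned B B-authorized
      with C , C⊆B , ∣C∣≡t , C⊈G ← authorized⇒basis G (suc r) (s≤s 1≤r) B-authorized
      = suc r , element , (λ j → C⊆B (element∈ j)) , proj₁ span , λ i → ≈-sym (proj₂ span i)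
      where
      open Enumeration (enumerateAs C ∣C∣≡t)
      independence : LinearlyIndependent (v ∘ element)
      independence = points-generic embed λ i elements∈G →
        C⊈G i λ P∈C → subst (_∈ group G i) (element-index P∈C) (elements∈G (index P∈C))
      span : ∃[ a ] lincomb a (v ∘ element) ≋ D
      span = independent⇒spanning {v = v ∘ element} independence D

    -- A set of at most r participants extends to r participants, whose points
    -- form a basis of the space together with D.
    small⇒separated : r ≤ p → ∀ B → ∣ B ∣ ≤ r → Separated B
    small⇒separated r≤p B ∣B∣≤r
      with C , B⊆C , _ , ∣C∣≡r ← interpolate {B = ⊤} (⊆⊤ {p = B}) ∣B∣≤r
             (subst (r ≤_) (sym (∣⊤∣≡n p)) r≤p)
      = proj₁ dual , proj₂ dual zero , λ P P∈B →
          subst (λ P → dot (proj₁ dual) (v P) ≈ 0#) (element-index (B⊆C P∈B))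
            (proj₂ dual (suc (index (B⊆C P∈B))))
      where
      open Enumeration (enumerateAs C ∣C∣≡r)
      family : Vector (Vector Carrier (suc r)) (suc r)
      family = coords ∘ (dealer Vector.∷ (point ∘ element))
      dual : ∃[ g ] ∀ j → dot g (family j) ≈ dealerValues j
      dual = independent⇒dual {v = family} (dealer-generic embed) dealerValues

    separated-⊆ : ∀ {B C} → B ⊆ C → Separated C → Separated B
    separated-⊆ B⊆C (g , g·D≈1 , g·C≈0) = g , g·D≈1 , λ P P∈B → g·C≈0 P (B⊆C P∈B)

    group⇒separated : ∀ i → Separated (group G i)
    group⇒separated i = proj₁ dual , proj₂ dual zero , vanishes
      where
      family : Vector (Vector Carrier (suc r)) (suc r)
      family = D Vector.∷ basis (H i)
      independence : LinearlyIndependent family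
      independence = adjoin-independent {D = D} {v = basis (H i)} (independent (H i)) (dealer∉H i)
      dual : ∃[ g ] ∀ j → dot g (family j) ≈ dealerValues j
      dual = independent⇒dual {v = family} independence dealerValues
      vanishes : ∀ P → P ∈ group G i → dot (proj₁ dual) (v P) ≈ 0#
      vanishes P P∈G = dot-lincomb-zero (proj₁ dual) (proj₁ (point∈H P∈G)) {v = basis (H i)}
        (proj₂ (point∈H P∈G)) (λ j → proj₂ dual (suc j))

    unauthorized⇒separated : suc r ≤ p → ∀ B → ¬ Authorized G (suc r) B → Separated B
    unauthorized⇒separated t≤p B B∉Γ =
      [ (λ ∣B∣<t → small⇒separated (ℕ.<⇒≤ t≤p) B (ℕ.≤-pred ∣B∣<t))
      , (λ (i , B⊆Gᵢ) → separated-⊆ {B} B⊆Gᵢ (group⇒separated i))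
      ]′ (unauthorized G (suc r) B∉Γ)

    scheme : Σ[ 𝒮 ∈ PerfectScheme (parallelAccess G (suc r)) ] IsIdeal 𝒮
    scheme with suc r ℕ.≤? p
    ... | yes t≤p = LinearScheme.scheme (parallelAccess G (suc r)) D v
                      authorized⇒spanned (unauthorized⇒separated t≤p)
    ... | no t≰p  = trivialScheme (parallelAccess G (suc r)) λ B (t≤B , _) →
                      t≰p (ℕ.≤-trans t≤B (∣p∣≤n B))

  module ParcScheme
    {r : ℕ} (1≤r : 1 ≤ r) {n : ℕ} (m≤q+1 : suc n ≤ suc q)
    (h : Fin (suc n) → ℕ) (1≤h : ∀ i → 1 ≤ h i)
    {k : ℕ} (Ψ : Fin (suc q) → Hyperplane r) (K : Fin k → Point r) (parc : IsParc Ψ K)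
    (sizes : ∀ i → (λ j → K j liesIn Ψ (inject≤ i m≤q+1)) HasSize h i)
    (k≡∑h : k ≡ sum (tabulate h))
    where

    -- The part of the parc in hyperplane i, for the first n + 1 hyperplanes.
    section : Fin (suc n) → Subset k
    section i = proj₁ (sizes i)

    ∣section∣ : ∀ i → ∣ section i ∣ ≡ h i
    ∣section∣ i = proj₂ (proj₂ (sizes i))

    ∈section⇔ : ∀ i x → x ∈ section i ⇔ K x liesIn Ψ (inject≤ i m≤q+1)
    ∈section⇔ i x = proj₁ (proj₂ (sizes i)) x

    hyperplane-unique : ∀ {i j} x → K x liesIn Ψ i → K x liesIn Ψ j → i ≡ j
    hyperplane-unique {i} {j} x x∈Ψᵢ x∈Ψⱼ = decidable-stable (i ≟ j) λ i≢j →
      IsParc.disjoint parc i≢j x (x∈Ψᵢ , x∈Ψⱼ)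

    section-hyperplane : ∀ {i j x} → x ∈ section i → K x liesIn Ψ j → inject≤ i m≤q+1 ≡ j
    section-hyperplane {i} {j} {x} x∈ = hyperplane-unique x (Equivalence.to (∈section⇔ i x) x∈)

    section-unique : ∀ {i j x} → x ∈ section i → x ∈ section j → i ≡ j
    section-unique {i} {j} {x} x∈ x∈′ = inject≤-injective m≤q+1 m≤q+1 i j
      (section-hyperplane x∈ (Equivalence.to (∈section⇔ j x) x∈′))

    section-cover : ∀ x → ∃[ i ] x ∈ section i
    section-cover = disjoint∧sum≡⇒cover section section-unique
      (trans (cong sum (tabulate-cong ∣section∣)) (sym k≡∑h))

    -- The participants are the points outside the first hyperplane.
    participants : Enumeration (∁ (section zero)) (k ∸ h zero)
    participants = enumerateAs (∁ (section zero))
      (trans (∣∁p∣≡n∸∣p∣ (section zero)) (cong (k ∸_) (∣section∣ zero)))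

    open Enumeration participants

    -- The participants of group i are the points in hyperplane i + 1.
    members : Fin n → Subset (k ∸ h zero)
    members i = comprehension (λ P → element P ∈? section (suc i))

    ∈members⇔ : ∀ i P → P ∈ members i ⇔ element P ∈ section (suc i)
    ∈members⇔ i = ∈-comprehension (λ P → element P ∈? section (suc i))

    ∣members∣ : ∀ i → ∣ members i ∣ ≡ h (suc i)
    ∣members∣ i = trans (ℕ.≤-antisym members≤ section≤) (∣section∣ (suc i))
      where
      members≤ : ∣ members i ∣ ≤ ∣ section (suc i) ∣
      members≤ = injection⇒∣∣≤ (λ {P} _ → element P)
        (λ {P} → Equivalence.to (∈members⇔ i P)) (λ _ _ → element-injective)
      outside₀ : ∀ {x} → x ∈ section (suc i) → x ∈ ∁ (section zero)
      outside₀ x∈ = x∉p⇒x∈∁p λ x∈₀ → contradiction (section-unique x∈₀ x∈) λ ()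
      section≤ : ∣ section (suc i) ∣ ≤ ∣ members i ∣
      section≤ = injection⇒∣∣≤ (λ x∈ → index (outside₀ x∈))
        (λ x∈ → Equivalence.from (∈members⇔ i _)
          (subst (_∈ section (suc i)) (sym (element-index (outside₀ x∈))) x∈))
        (λ x∈ y∈ eq → trans (sym (element-index (outside₀ x∈)))
          (trans (cong element eq) (element-index (outside₀ y∈))))

    G : Partition (k ∸ h zero) n
    G = record
      { group    = members
      ; nonempty = λ i → 1≤∣S∣⇒Nonempty (subst (1 ≤_) (sym (∣members∣ i)) (1≤h (suc i)))
      ; disjoint = λ {i} {j} i≢j (P , P∈) → i≢j (suc-injective (section-unique
          (Equivalence.to (∈members⇔ i P) (proj₁ (x∈p∩q⁻ (members i) (members j) P∈)))
          (Equivalence.to (∈members⇔ j P) (proj₂ (x∈p∩q⁻ (members i) (members j) P∈)))))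
      ; covering = covering
      }
      where
      covering : ∀ P → ∃[ i ] P ∈ members i
      covering P with section-cover (element P)
      ... | zero  , P∈ = contradiction P∈ (x∈∁p⇒x∉p (element∈ P))
      ... | suc i , P∈ = i , Equivalence.from (∈members⇔ i P) P∈

    groupHyperplane : Fin n → Hyperplane r
    groupHyperplane i = Ψ (inject≤ (suc i) m≤q+1)

    member∈hyperplane : ∀ {i P} → P ∈ members i → K (element P) liesIn groupHyperplane i
    member∈hyperplane {i} {P} P∈ =
      Equivalence.to (∈section⇔ (suc i) (element P)) (Equivalence.to (∈members⇔ i P) P∈)

    hyperplane⇒member : ∀ {i P} → K (element P) liesIn groupHyperplane i → P ∈ members i
    hyperplane⇒member {i} {P} P∈Ψ =
      Equivalence.from (∈members⇔ i P) (Equivalence.from (∈section⇔ (suc i) (element P)) P∈Ψ)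

    -- The point of the dealer is an arbitrary point of the parc in the first
    -- hyperplane.
    dealer∃ : Nonempty (section zero)
    dealer∃ = 1≤∣S∣⇒Nonempty (subst (1 ≤_) (sym (∣section∣ zero)) (1≤h zero))

    dealer : Fin k
    dealer = proj₁ dealer∃

    dealer∈ : dealer ∈ section zero
    dealer∈ = proj₂ dealer∃

    dealer∉hyperplane : ∀ i → ¬ K dealer liesIn groupHyperplane i
    dealer∉hyperplane i D∈Ψ = contradiction
      (section-unique dealer∈ (Equivalence.from (∈section⇔ (suc i) dealer) D∈Ψ)) λ ()

    -- Each point lies in only one hyperplane of the pencil, so a hyperplane that
    -- contains all the points is that of the group of the first participant.
    points-generic : ∀ (s : Fin (suc r) ↣ Fin (k ∸ h zero)) →
                     (∀ i → ¬ (∀ a → Injection.to s a ∈ members i)) →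
                     Independent (K ∘ element ∘ Injection.to s)
    points-generic s ¬members = IsParc.generic parc
      (mk↣ {to = element ∘ Injection.to s} (Injection.injective s ∘ element-injective))
      λ (j , s∈Ψⱼ) → ¬members (home .proj₁) λ a → hyperplane⇒member
        (subst (λ j → K (element (Injection.to s a)) liesIn Ψ j)
          (sym (hyperplane-unique _ (member∈hyperplane (home .proj₂)) (s∈Ψⱼ zero))) (s∈Ψⱼ a))
      where
      home : ∃[ i ] Injection.to s zero ∈ members i
      home = Partition.covering G (Injection.to s zero)

    -- As r is positive there is a participant among the points; the hyperplane of
    -- its group is the only candidate for a common one, and it misses the dealer.
    dealer-generic : ∀ (s : Fin r ↣ Fin (k ∸ h zero)) →
                     Independent (K dealer Vector.∷ (K ∘ element ∘ Injection.to s))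
    dealer-generic s = IsParc.generic parc (mk↣ {to = points} points-injective) λ (j , points∈Ψⱼ) →
      dealer∉hyperplane (home .proj₁)
        (subst (λ j → K dealer liesIn Ψ j)
          (sym (hyperplane-unique _ (member∈hyperplane (home .proj₂)) (points∈Ψⱼ (suc first))))
          (points∈Ψⱼ zero))
      where
      first : Fin r
      first = fromℕ< 1≤r
      home : ∃[ i ] Injection.to s first ∈ members i
      home = Partition.covering G (Injection.to s first)
      points : Fin (suc r) → Fin k
      points = dealer Vector.∷ (element ∘ Injection.to s)
      dealer≢element : ∀ P → dealer ≢ element P
      dealer≢element P eq = x∈∁p⇒x∉p (element∈ P) (subst (_∈ section zero) eq dealer∈)
      points-injective : ∀ {i j} → points i ≡ points j → i ≡ j
      points-injective {zero}  {zero}  _  = refl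
      points-injective {zero}  {suc j} eq = contradiction eq (dealer≢element (Injection.to s j))
      points-injective {suc i} {zero}  eq = contradiction (sym eq) (dealer≢element (Injection.to s i))
      points-injective {suc i} {suc j} eq = cong suc (Injection.injective s (element-injective eq))

    open PointScheme 1≤r G (K dealer) (K ∘ element) groupHyperplane
      member∈hyperplane dealer∉hyperplane points-generic dealer-generic public
      using (scheme)


theorem4p1 : ∀ {c ℓ₁ ℓ₂} (q : ℕ) → IsPrimePower q →
    (F : HeytingField c ℓ₁ ℓ₂) → HasOrder F q →
    let open Projective F in
    (t : ℕ) → 2 ≤ t →
    -- m = suc m-1 ≥ 1
    (m-1 : ℕ) (m≤q+1 : suc m-1 ≤ suc q)
    (h : Fin (suc m-1) → ℕ) → (∀ i → 1 ≤ h i) → (∀ i → h zero ≤ h i) →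
    (k : ℕ) (Ψ : Fin (suc q) → Hyperplane (t ∸ 1)) (K : Fin k → Point (t ∸ 1)) →
    IsParc Ψ K →
    (∀ i → (λ j → K j liesIn Ψ (inject≤ i m≤q+1)) HasSize h i) →
    k ≡ sum (tabulate h) →
    -- the groups are the K ∩ Ψᵢ with 1 ≤ i ≤ m - 1, of sizes h₁, …, hₘ₋₁
    Σ[ G ∈ Partition (k ∸ h zero) m-1 ] (∀ i → ∣ group G i ∣ ≡ h (suc i)) ×
    (Σ[ 𝒜 ∈ AccessStructure (k ∸ h zero) ] IsParallelModel t G 𝒜 ×
    (Σ[ 𝒮 ∈ PerfectScheme 𝒜 ] IsIdeal 𝒮))
theorem4p1 q _ F order (suc r) 2≤t@(s≤s 1≤r) n m≤q+1 h 1≤h _ k Ψ K parc sizes k≡∑h =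
  G , ∣members∣ , parallelAccess G (suc r) , parallelAccess-isParallelModel G (suc r) 2≤t , scheme
  where open Construction.ParcScheme F order 1≤r m≤q+1 h 1≤h Ψ K parc sizes k≡∑h
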